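{- For every integer $k\ge 1$, there are only finitely many (up to isomorphism) $k$-vertex-critical $(\text{co-gem}, \text{paw}+P_1)$-free graphs.
   Context: All graphs are finite and simple. $\chi(G)$ denotes the chromatic number of $G$. A graph $G$ is $k$-vertex-critical if $\chi(G)=k$ and $\chi(G-v)<k$ for every $v\in V(G)$. $P_n$ denotes the path on $n$ vertices and $G+H$ denotes the disjoint union of graphs $G$ and $H$. The co-gem is the graph $P_4+P_1$. The paw is the graph on four vertices obtained from a triangle by adding one new vertex adjacent to exactly one vertex of the triangle. A graph is $(H_1,\dots,H_m)$-free if none of $H_1,\dots,H_m$ is isomorphic to an induced subgraph of it. -}

module Defs where

open import Data.Bool using (Bool; true; false; _∨_; not)
open import Data.Bool.Properties using (∨-comm)
open import Data.Empty using (⊥-elim)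
open import Data.Fin using (Fin; zero; suc; toℕ; splitAt; punchIn; _≟_)
open import Data.Fin.Properties using (punchIn-injective)
open import Data.List using (List)
open import Data.List.Relation.Unary.Any using (Any)
open import Data.Nat using (ℕ; zero; suc; pred; _+_; _≤_; _<_; _≡ᵇ_)
open import Data.Product using (Σ-syntax; ∃; ∃-syntax; _×_; _,_; proj₂)
open import Data.Sum using (_⊎_; inj₁; inj₂)
open import Function.Bundles using (_↣_; _↔_; mk↣; module Injection; module Inverse)
open import Relation.Binary.PropositionalEquality using (_≡_; _≢_; refl; sym; cong₂)
open import Relation.Nullary using (¬_; yes; no; does)

record Graph (n : ℕ) : Set where
  field
    adj       : Fin n → Fin n → Bool
    symmetric : ∀ u v → adj u v ≡ adj v u
    loopless  : ∀ v → adj v v ≡ false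

open Graph public

infix 4 _≅_

_≅_ : ∀ {m n} → Graph m → Graph n → Set
_≅_ {m} {n} G H =
  Σ[ f ∈ Fin m ↔ Fin n ] (∀ u v → adj G u v ≡ adj H (Inverse.to f u) (Inverse.to f v))

-- The subgraph of G induced by the image of the injection f, with the vertex
-- f i renamed to i.  Every induced subgraph arises this way, since every
-- subset of Fin n is the image of an injection from some Fin m.
induced : ∀ {m n} → Graph n → Fin m ↣ Fin n → Graph m
induced G f = record
  { adj       = λ i j → adj G (to i) (to j)
  ; symmetric = λ i j → symmetric G (to i) (to j)
  ; loopless  = λ i → loopless G (to i)
  }
  where open Injection f using (to)

_IsInducedSubgraphOf_ : ∀ {m n} → Graph m → Graph n → Set
_IsInducedSubgraphOf_ {n = n} H G =
  ∃[ l ] Σ[ f ∈ Fin l ↣ Fin n ] H ≅ induced G f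

_IsFreeOf_ : ∀ {m n} → Graph n → Graph m → Set
G IsFreeOf H = ¬ (H IsInducedSubgraphOf G)

infixl 6 _-ᵥ_

-- punchIn v is the injection whose image is all vertices other than v.
_-ᵥ_ : ∀ {n} → Graph n → Fin n → Graph (pred n)
_-ᵥ_ {suc n} G v = induced G (mk↣ {to = punchIn v} (punchIn-injective v _ _))

Colourable : ∀ {n} → ℕ → Graph n → Set
Colourable {n} k G =
  Σ[ c ∈ (Fin n → Fin k) ] (∀ u v → adj G u v ≡ true → c u ≢ c v)

-- χ[ G ]≡ k says that k is the least number of colours in a proper
-- colouring of G.
χ[_]≡_ : ∀ {n} → Graph n → ℕ → Set
χ[ G ]≡ k = Colourable k G × (∀ j → Colourable j G → k ≤ j)

χ[_]<_ : ∀ {n} → Graph n → ℕ → Set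
χ[ G ]< k = ∃[ j ] (χ[ G ]≡ j) × j < k

VertexCritical : ∀ {n} → ℕ → Graph n → Set
VertexCritical k G = (χ[ G ]≡ k) × (∀ v → χ[ G -ᵥ v ]< k)

-- The path 0 - 1 - ... - (n-1).
P : ∀ n → Graph n
P n = record
  { adj       = λ u v → next u v ∨ next v u
  ; symmetric = λ u v → ∨-comm (next u v) (next v u)
  ; loopless  = λ v → cong₂ _∨_ (n≢ᵇ1+n (toℕ v)) (n≢ᵇ1+n (toℕ v))
  }
  where
  next : Fin n → Fin n → Bool
  next u v = suc (toℕ u) ≡ᵇ toℕ v

  n≢ᵇ1+n : ∀ i → (suc i ≡ᵇ i) ≡ false
  n≢ᵇ1+n zero    = refl
  n≢ᵇ1+n (suc i) = n≢ᵇ1+n i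

K : ∀ n → Graph n
K n = record
  { adj       = λ u v → not (does (u ≟ v))
  ; symmetric = ≟-sym
  ; loopless  = ≟-refl
  }
  where
  ≟-sym : ∀ (u v : Fin n) → not (does (u ≟ v)) ≡ not (does (v ≟ u))
  ≟-sym u v with u ≟ v | v ≟ u
  ... | yes _   | yes _   = refl
  ... | no _    | no _    = refl
  ... | yes u≡v | no v≢u  = ⊥-elim (v≢u (sym u≡v))
  ... | no u≢v  | yes v≡u = ⊥-elim (u≢v (sym v≡u))

  ≟-refl : ∀ (v : Fin n) → not (does (v ≟ v)) ≡ false
  ≟-refl v with v ≟ v
  ... | yes _  = refl
  ... | no v≢v = ⊥-elim (v≢v refl)

infixl 6 _⊕_

-- Disjoint union: splitAt m identifies Fin (m + n) with Fin m ⊎ Fin n.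
_⊕_ : ∀ {m n} → Graph m → Graph n → Graph (m + n)
_⊕_ {m} {n} G H = record
  { adj       = λ u v → adj⊎ (splitAt m u) (splitAt m v)
  ; symmetric = λ u v → sym⊎ (splitAt m u) (splitAt m v)
  ; loopless  = λ v → loopless⊎ (splitAt m v)
  }
  where
  adj⊎ : Fin m ⊎ Fin n → Fin m ⊎ Fin n → Bool
  adj⊎ (inj₁ u) (inj₁ v) = adj G u v
  adj⊎ (inj₂ u) (inj₂ v) = adj H u v
  adj⊎ (inj₁ _) (inj₂ _) = false
  adj⊎ (inj₂ _) (inj₁ _) = false

  sym⊎ : ∀ x y → adj⊎ x y ≡ adj⊎ y x
  sym⊎ (inj₁ u) (inj₁ v) = symmetric G u v
  sym⊎ (inj₂ u) (inj₂ v) = symmetric H u v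
  sym⊎ (inj₁ _) (inj₂ _) = refl
  sym⊎ (inj₂ _) (inj₁ _) = refl

  loopless⊎ : ∀ x → adj⊎ x x ≡ false
  loopless⊎ (inj₁ v) = loopless G v
  loopless⊎ (inj₂ v) = loopless H v

-- G with a new vertex zero whose only neighbour is the old vertex w
-- (old vertices are shifted by suc).
addPendant : ∀ {n} → Graph n → Fin n → Graph (suc n)
addPendant {n} G w = record
  { adj       = adj′
  ; symmetric = sym′
  ; loopless  = loopless′
  }
  where
  adj′ : Fin (suc n) → Fin (suc n) → Bool
  adj′ zero    zero    = false
  adj′ zero    (suc v) = does (v ≟ w)
  adj′ (suc u) zero    = does (u ≟ w)
  adj′ (suc u) (suc v) = adj G u v

  sym′ : ∀ u v → adj′ u v ≡ adj′ v u
  sym′ zero    zero    = refl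
  sym′ zero    (suc v) = refl
  sym′ (suc u) zero    = refl
  sym′ (suc u) (suc v) = symmetric G u v

  loopless′ : ∀ v → adj′ v v ≡ false
  loopless′ zero    = refl
  loopless′ (suc v) = loopless G v

co-gem : Graph 5
co-gem = P 4 ⊕ P 1

paw : Graph 4
paw = addPendant (K 3) zero

-- Finiteness up to isomorphism of a class of graphs (of arbitrary orders):
-- some finite list meets the isomorphism class of every member.
FinitelyManyUpToIso : (∀ {n} → Graph n → Set) → Set
FinitelyManyUpToIso C =
  Σ[ L ∈ List (∃ Graph) ] (∀ {n} (G : Graph n) → C G → Any (λ H → G ≅ proj₂ H) L)

{-# OPTIONS --safe #-}
module Submission where

-- A maximal clique Q has at most k vertices, and every vertex is a non-neighbour of some q in Q, so it
-- suffices to bound the set M of non-neighbours of a vertex q.  Two non-adjacent vertices of M with a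
-- common neighbour in M have the same neighbours in M, so the components of G[M] are complete
-- multipartite; one representative of each twin class yields a disjoint union of cliques.
--
-- Let A be a twin class of G[M].  Since G is co-gem-free, the sets S z = A \ N(z), for z in N(q), are
-- pairwise nested or disjoint.  Colour G - a with fewer than k colours.  If b in A has colour c, then a
-- has a neighbour z of colour c, z lies in N(q), and S z contains all vertices of A of colour c but not
-- a.  So A minus a is covered by fewer than k sets S z avoiding a, and a nested-or-disjoint family with
-- this property for every a has a ground set of bounded size.  The same argument, recolouring a whole
-- component by the colours of another one, bounds the number of components with equal clique number.

open import Defs
open import Data.Bool using (Bool; true; false; _∧_)
open import Data.Bool.Properties using (¬-not; ∧-comm; ∧-idem; ∧-identityʳ; ∧-zeroʳ) renaming (_≟_ to _≟ᵇ_)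
open import Data.Empty using (⊥; ⊥-elim)
open import Data.Fin using (Fin; zero; suc; toℕ; fromℕ<; cast; punchOut) renaming (_≟_ to _≟ᶠ_)
open import Data.Fin.Properties
  using (all?; punchIn-punchOut; toℕ<n; toℕ-injective; toℕ-fromℕ<; toℕ-cast) renaming (any? to anyFin?)
open import Data.List
  using (List; []; _∷_; length; filter; lookup; allFin; upTo; map; cartesianProductWith; concatMap)
open import Data.List.Properties using (length-upTo; length-tabulate; filter-notAll)
open import Data.List.Membership.Propositional using (_∈_; find; lose)
open import Data.List.Membership.Propositional.Properties
  using (∈-filter⁺; ∈-filter⁻; ∈-allFin; ∈-lookup; ∈-upTo⁺; ∈-map⁺; ∈-cartesianProductWith⁺; ∈-concatMap⁺)
open import Data.List.Relation.Unary.All as All using (All; []; _∷_)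
open import Data.List.Relation.Unary.All.Properties using (all-filter; ¬Any⇒All¬) renaming (filter⁺ to All-filter⁺)
open import Data.List.Relation.Unary.AllPairs as AllPairs using (AllPairs; []; _∷_)
open import Data.List.Relation.Unary.Any as Any using (Any; here; there; any?)
open import Data.List.Relation.Unary.Any.Properties using (lookup-index)
open import Data.List.Relation.Unary.Unique.Propositional using (Unique)
open import Data.List.Relation.Unary.Unique.Propositional.Properties
  using (allFin⁺) renaming (filter⁺ to Unique-filter⁺)
open import Data.Nat using (ℕ; zero; suc; _+_; _*_; _≤_; _<_; _≥_; z≤n; s≤s; s≤s⁻¹; _≤?_)
open import Data.Nat.Properties
  using (≤-trans; ≤-reflexive; <⇒≱; <⇒≤; ≰⇒>; +-mono-≤; +-suc; *-identityʳ) renaming (_≟_ to _≟ℕ_)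
open import Data.Product using (∃; ∃-syntax; Σ-syntax; _×_; _,_; proj₁; proj₂)
open import Data.Sum using (_⊎_; inj₁; inj₂)
open import Data.Unit using (⊤)
open import Data.Vec as Vec using (Vec; []; _∷_)
open import Data.Vec.Properties using (lookup∘tabulate)
open import Function using (_∘_; _$_)
open import Function.Bundles using (mk↣)
open import Function.Construct.Identity using (↔-id)
open import Level using (0ℓ)
open import Relation.Binary.Core using (Rel)
open import Relation.Binary.Definitions as B using (DecidableEquality; Reflexive; Symmetric)
open import Relation.Binary.PropositionalEquality
  using (_≡_; _≢_; refl; sym; trans; cong; cong₂; subst; ≢-sym)
open import Relation.Nullary using (¬_; Dec; yes; no; ¬?; contradiction; _×-dec_; _⊎-dec_)
open import Relation.Nullary.Decidable using (toWitness; True; _→-dec_)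
open import Relation.Unary using (Pred; Decidable)

-- Lists: pairwise relations, duplicates and greedy selection.

private variable
  A : Set

pairwise : {R : Rel A 0ℓ} {xs : List A} {x y : A} → Symmetric R → AllPairs R xs →
           x ∈ xs → y ∈ xs → x ≢ y → R x y
pairwise R-sym (_   ∷ _ ) (here refl) (here refl) x≢y = contradiction refl x≢y
pairwise R-sym (rxs ∷ _ ) (here refl) (there y∈)  x≢y = All.lookup rxs y∈
pairwise R-sym (rxs ∷ _ ) (there x∈)  (here refl) x≢y = R-sym (All.lookup rxs x∈)
pairwise R-sym (_   ∷ rs) (there x∈)  (there y∈)  x≢y = pairwise R-sym rs x∈ y∈ x≢y

lookup-injective : {xs : List A} → Unique xs → ∀ {i j} → lookup xs i ≡ lookup xs j → i ≡ j
lookup-injective (_ ∷ _)    {zero}  {zero}  _  = refl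
lookup-injective (x∉ ∷ _)   {zero}  {suc j} eq = contradiction eq (All.lookup x∉ (∈-lookup j))
lookup-injective (x∉ ∷ _)   {suc i} {zero}  eq = contradiction (sym eq) (All.lookup x∉ (∈-lookup i))
lookup-injective (_ ∷ uniq) {suc i} {suc j} eq = cong suc (lookup-injective uniq eq)

∃-other : DecidableEquality A → {xs : List A} → Unique xs → 2 ≤ length xs → ∀ x → ∃[ y ] y ∈ xs × y ≢ x
∃-other _≟_ {y ∷ []}    _                    (s≤s ()) x
∃-other _≟_ {y ∷ z ∷ _} ((y≢z ∷ _) ∷ _) _ x with y ≟ x
... | no y≢x   = y , here refl , y≢x
... | yes refl = z , there (here refl) , ≢-sym y≢z

length≤1⇒≡ : {xs : List A} {x y : A} → length xs ≤ 1 → x ∈ xs → y ∈ xs → x ≡ y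
length≤1⇒≡ {xs = _ ∷ []}    _        (here refl) (here refl) = refl
length≤1⇒≡ {xs = _ ∷ _ ∷ _} (s≤s ())

-- An element is dropped only if one already chosen dominates it. Choices of `R` give a maximal
-- clique, one vertex per colour, one per twin class and one per component.
greedy : {R : Rel A 0ℓ} → B.Decidable R → Reflexive R → (xs : List A) →
         ∃[ ys ] All (_∈ xs) ys × AllPairs (λ x y → ¬ R x y) ys × (∀ {x} → x ∈ xs → Any (R x) ys)
greedy R? R-refl [] = [] , [] , [] , λ ()
greedy R? R-refl (x ∷ xs) with greedy R? R-refl xs
... | ys , ys⊆ , sep , dom with any? (R? x) ys
...   | yes x-dom = ys , All.map there ys⊆ , sep , λ where
          (here refl) → x-dom
          (there x∈)  → dom x∈
...   | no ¬x-dom = x ∷ ys , here refl ∷ All.map there ys⊆ , ¬Any⇒All¬ ys ¬x-dom ∷ sep , λ where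
          (here refl) → here R-refl
          (there x∈)  → there (dom x∈)

-- Cardinality bounds, stated through duplicate-free lists.

Bounded : Pred A 0ℓ → ℕ → Set
Bounded P b = ∀ {xs} → Unique xs → All P xs → length xs ≤ b

length-split : {P : Pred A 0ℓ} (P? : Decidable P) (xs : List A) →
               length xs ≤ length (filter P? xs) + length (filter (¬? ∘ P?) xs)
length-split P? [] = z≤n
length-split P? (x ∷ xs) with P? x
... | yes _ = s≤s (length-split P? xs)
... | no  _ = ≤-trans (s≤s (length-split P? xs)) (≤-reflexive (sym (+-suc _ _)))

-- Induction on `ys`: the elements in the first set are counted by `b`, and the others satisfy
-- `P x × ¬ R y x`, which the remaining sets cover.
Bounded-cover : {I : Set} {P : Pred A 0ℓ} {R : I → Pred A 0ℓ} (ys : List I) {m b : ℕ} → length ys ≤ m →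
                (∀ y → Decidable (R y)) → (∀ {x} → P x → Any (λ y → R y x) ys) →
                (∀ {y} → y ∈ ys → Bounded (λ x → P x × R y x) b) → Bounded P (m * b)
Bounded-cover []       _         R? cov bnd {[]}    _ _        = z≤n
Bounded-cover []       _         R? cov bnd {_ ∷ _} _ (px ∷ _) = contradiction (cov px) λ ()
Bounded-cover {P = P} {R} (y ∷ ys) (s≤s len) R? cov bnd {xs} uniq all =
  ≤-trans (length-split (R? y) xs)
    (+-mono-≤ (bnd (here refl) (Unique-filter⁺ (R? y) uniq)
                 (All.zip (All-filter⁺ (R? y) all , all-filter (R? y) xs)))
              (Bounded-cover {P = λ x → P x × ¬ R y x} ys len R? cov′ bnd′
                 (Unique-filter⁺ (¬? ∘ R? y) uniq)
                 (All.zip (All-filter⁺ (¬? ∘ R? y) all , all-filter (¬? ∘ R? y) xs))))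
  where
  cov′ : ∀ {x} → P x × ¬ R y x → Any (λ z → R z x) ys
  cov′ (px , ¬ryx) with cov px
  ... | here ryx = contradiction ryx ¬ryx
  ... | there p  = p

  bnd′ : ∀ {z} → z ∈ ys → Bounded (λ x → (P x × ¬ R y x) × R z x) _
  bnd′ z∈ uniq′ all′ = bnd (there z∈) uniq′ (All.map (λ ((px , _) , rzx) → px , rzx) all′)

Bounded-≡ : {P : Pred A 0ℓ} → (∀ {x y} → P x → P y → x ≡ y) → Bounded P 1
Bounded-≡ eq []                   _             = z≤n
Bounded-≡ eq (_ ∷ [])             _             = s≤s z≤n
Bounded-≡ eq ((x≢y ∷ _) ∷ _ ∷ _) (px ∷ py ∷ _) = contradiction (eq px py) x≢y

Bounded-injective : {P : Pred A 0ℓ} {m : ℕ} (c : A → ℕ) → (∀ {x} → P x → c x < m) →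
                    (∀ {x y} → P x → P y → c x ≡ c y → x ≡ y) → Bounded P m
Bounded-injective {m = m} c c< inj =
  subst (Bounded _) (*-identityʳ m) $
  Bounded-cover (upTo m) (≤-reflexive (length-upTo m)) (λ i x → i ≟ℕ c x)
    ∈-upTo⁺′ (λ _ → Bounded-≡ λ (px , i≡cx) (py , i≡cy) → inj px py (trans (sym i≡cx) i≡cy))
  where
  ∈-upTo⁺′ : ∀ {x} → _ → Any (_≡ c x) (upTo m)
  ∈-upTo⁺′ px = Any.map sym (∈-upTo⁺ (c< px))

-- Laminar families.

laminarBound : ℕ → ℕ
laminarBound zero    = 1
laminarBound (suc s) = suc (suc s * laminarBound s)

1≤laminarBound : ∀ s → 1 ≤ laminarBound s
1≤laminarBound zero    = s≤s z≤n
1≤laminarBound (suc s) = s≤s z≤n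

module _ {X Z : Set} (S : Z → X → Set) where

  -- Any two of the sets S z ∩ A are nested or disjoint.
  Laminar : Pred X 0ℓ → Set
  Laminar A = ∀ {z w a b d} → A a → A b → A d →
    ¬ S z a → S z b → S z d → S w a → ¬ S w b → S w d → ⊥

  Covered : ℕ → Pred X 0ℓ → Set
  Covered s A = ∀ {a} → A a →
    ∃[ zs ] length zs ≤ s × (∀ {b} → A b → a ≢ b → Any (λ z → ¬ S z a × S z b) zs)

-- A set T = S z avoiding a needs one covering set fewer: for b in T, the set that
-- separates a from b is disjoint from T, so it does not help to cover T minus b.
Covered-inside : {X Z : Set} {S : Z → X → Set} → (∀ z x → Dec (S z x)) →
                 ∀ {s A} → Laminar S A → Covered S (suc s) A → ∀ {a z} → A a →
                 Covered S s (λ x → (A x × a ≢ x) × ¬ S z a × S z x)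
Covered-inside {S = S} S? {s} {A} lam cov {a} {z} Aa {b} ((Ab , a≢b) , ¬za , zb) with cov Ab
... | zs , len , sep =
  filter avoids-a? zs ,
  s≤s⁻¹ (≤-trans (filter-notAll avoids-a? zs (Any.map (λ (_ , wa) ¬wa → ¬wa wa) (sep Aa (≢-sym a≢b)))) len) ,
  λ ((Ad , _) , _ , zd) b≢d →
    let w , w∈zs , ¬wb , wd = find (sep Ad b≢d)
    in lose (∈-filter⁺ avoids-a? w∈zs (λ wa → lam Aa Ab Ad ¬za zb zd wa ¬wb wd)) (¬wb , wd)
  where
  avoids-a? : Decidable (λ w → ¬ S w a)
  avoids-a? w = ¬? (S? w a)

-- Induction on `s`. Apart from one element `a`, the ground set is covered by at most `suc s` sets
-- avoiding `a`, and inside each of them `s` sets suffice; this is the recurrence of `laminarBound`.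
-- With no covering sets there is no second element.
Laminar⇒Bounded : {X Z : Set} {S : Z → X → Set} → (∀ z x → Dec (S z x)) →
                  ∀ s {A} → Laminar S A → Covered S s A → Bounded A (laminarBound s)
Laminar⇒Bounded S? s       lam cov {[]}        _          _        = z≤n
Laminar⇒Bounded S? zero    lam cov {_ ∷ []}    _          _        = s≤s z≤n
Laminar⇒Bounded S? zero    lam cov {_ ∷ _ ∷ _} ((a≢b ∷ _) ∷ _) (Aa ∷ Ab ∷ _) with cov Aa
... | [] , _ , sep = contradiction (sep Ab a≢b) λ ()
Laminar⇒Bounded {S = S} S? (suc s) lam cov {a ∷ xs} (a∉xs ∷ uniq) (Aa ∷ Axs) with cov Aa
... | zs , len , sep =
  s≤s (Bounded-cover {R = λ z x → ¬ S z a × S z x} zs len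
        (λ z x → ¬? (S? z a) ×-dec S? z x)
        (λ (Ax , a≢x) → sep Ax a≢x)
        (λ _ → Laminar⇒Bounded S? s
          (λ ((Aa , _) , _) ((Ab , _) , _) ((Ad , _) , _) → lam Aa Ab Ad)
          (Covered-inside S? lam cov Aa))
        uniq (All.zip (Axs , a∉xs)))

-- Induced subgraphs, adjacency and twins.

module _ {m n} (H : Graph m) (G : Graph n) (f : Fin m → Fin n) where

  Matches : Fin m → Fin m → Set
  Matches i j = adj H i j ≡ adj G (f i) (f j)

  -- Injectivity of f is automatic when no two vertices of H have the same neighbours.
  embeds : True (all? λ i → all? λ j → all? (λ l → adj H i l ≟ᵇ adj H j l) →-dec (i ≟ᶠ j)) →
           AllPairs Matches (allFin m) → H IsInducedSubgraphOf G
  embeds distinct upper = m , mk↣ {to = f} (λ fi≡fj → toWitness distinct _ _ λ l →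
      trans (matches _ l) (trans (cong (λ v → adj G v (f l)) fi≡fj) (sym (matches _ l)))) ,
    ↔-id _ , matches
    where
    matches : ∀ i j → Matches i j
    matches i j with i ≟ᶠ j
    ... | yes refl = trans (loopless H i) (sym (loopless G (f i)))
    ... | no i≢j   = pairwise (λ {i} {j} eq → trans (symmetric H j i) (trans eq (symmetric G (f i) (f j))))
                       upper (∈-allFin i) (∈-allFin j) i≢j

module Adjacency {n} (G : Graph n) where

  infix 4 _~_ _≁_ _~?_ _≁?_

  _~_ _≁_ : Fin n → Fin n → Set
  u ~ v = adj G u v ≡ true
  u ≁ v = adj G u v ≡ false

  _~?_ : ∀ u v → Dec (u ~ v)
  u ~? v = adj G u v ≟ᵇ true

  _≁?_ : ∀ u v → Dec (u ≁ v)
  u ≁? v = adj G u v ≟ᵇ false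

  ~-sym : ∀ {u v} → u ~ v → v ~ u
  ~-sym {u} {v} = trans (symmetric G v u)

  ≁-sym : ∀ {u v} → u ≁ v → v ≁ u
  ≁-sym {u} {v} = trans (symmetric G v u)

  ~-≁-contradiction : ∀ {ℓ} {W : Set ℓ} {u v} → u ~ v → u ≁ v → W
  ~-≁-contradiction u~v u≁v = contradiction (trans (sym u~v) u≁v) λ ()

  ~⇒≢ : ∀ {u v} → u ~ v → u ≢ v
  ~⇒≢ {u} u~u refl = ~-≁-contradiction u~u (loopless G u)

  Twins : Fin n → Fin n → Fin n → Set
  Twins q u v = ∀ x → q ≁ x → adj G u x ≡ adj G v x

  twins? : ∀ q u v → Dec (Twins q u v)
  twins? q u v = all? λ x → (q ≁? x) →-dec (adj G u x ≟ᵇ adj G v x)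

-- Consequences of the two forbidden subgraphs.

module ForbiddenSubgraphs {n} (G : Graph n) (no-co-gem : G IsFreeOf co-gem) (no-paw+P₁ : G IsFreeOf (paw ⊕ P 1)) where
  open Adjacency G

  ¬co-gem : ∀ {a b c d e} → a ~ b → b ~ c → c ~ d → a ≁ c → a ≁ d → b ≁ d →
            a ≁ e → b ≁ e → c ≁ e → d ≁ e → ⊥
  ¬co-gem {a} {b} {c} {d} {e} ab bc cd ac ad bd ae be ce de =
    no-co-gem (embeds co-gem G (Vec.lookup (a ∷ b ∷ c ∷ d ∷ e ∷ [])) _
      ((sym ab ∷ sym ac ∷ sym ad ∷ sym ae ∷ []) ∷ (sym bc ∷ sym bd ∷ sym be ∷ []) ∷
       (sym cd ∷ sym ce ∷ []) ∷ (sym de ∷ []) ∷ [] ∷ []))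

  ¬paw+P₁ : ∀ {a b c d e} → a ~ b → b ~ c → b ~ d → c ~ d → a ≁ c → a ≁ d →
            a ≁ e → b ≁ e → c ≁ e → d ≁ e → ⊥
  ¬paw+P₁ {a} {b} {c} {d} {e} ab bc bd cd ac ad ae be ce de =
    no-paw+P₁ (embeds (paw ⊕ P 1) G (Vec.lookup (a ∷ b ∷ c ∷ d ∷ e ∷ [])) _
      ((sym ab ∷ sym ac ∷ sym ad ∷ sym ae ∷ []) ∷ (sym bc ∷ sym bd ∷ sym be ∷ []) ∷
       (sym cd ∷ sym ce ∷ []) ∷ (sym de ∷ []) ∷ [] ∷ []))

  -- If `v ~ x`, the triangle `v`, `u`, `x` with pendant `w` is a paw; otherwise `x`, `u`, `v`, `w`
  -- is an induced path. In both cases `q` is the isolated vertex.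
  common-neighbour-half : ∀ {q u v w x} → q ≁ u → q ≁ v → q ≁ w → q ≁ x →
                          u ~ v → v ~ w → u ≁ w → u ~ x → w ≁ x → ⊥
  common-neighbour-half {v = v} {x = x} qu qv qw qx uv vw uw ux wx with v ~? x
  ... | yes vx = ¬paw+P₁ (~-sym vw) (~-sym uv) vx ux (≁-sym uw) wx
                   (≁-sym qw) (≁-sym qv) (≁-sym qu) (≁-sym qx)
  ... | no ¬vx = ¬co-gem (~-sym ux) uv vw (≁-sym (¬-not ¬vx)) (≁-sym wx) uw
                   (≁-sym qx) (≁-sym qu) (≁-sym qv) (≁-sym qw)

  common-neighbour⇒twins : ∀ {q u v w} → q ≁ u → q ≁ v → q ≁ w → u ~ v → v ~ w → u ≁ w → Twins q u w
  common-neighbour⇒twins {u = u} {w = w} qu qv qw uv vw uw x qx with adj G u x in ux | adj G w x in wx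
  ... | true  | true  = refl
  ... | false | false = refl
  ... | true  | false = ⊥-elim (common-neighbour-half qu qv qw qx uv vw uw ux wx)
  ... | false | true  = ⊥-elim (common-neighbour-half qw qv qu qx (~-sym vw) (~-sym uv) (≁-sym uw) wx ux)

  -- Otherwise `v`, `u`, `z`, `q` is an induced path and `w` is isolated from it.
  mixed-on-edge : ∀ {q z u v w} → q ≁ u → q ≁ v → q ≁ w → q ~ z → u ~ v → z ~ u → z ≁ v →
                  u ≁ w → v ≁ w → z ~ w
  mixed-on-edge {z = z} {w = w} qu qv qw qz uv zu zv uw vw with adj G z w in zw
  ... | true  = refl
  ... | false = ⊥-elim (¬co-gem (~-sym uv) (~-sym zu) (~-sym qz) (≁-sym zv) (≁-sym qv) (≁-sym qu) vw uw zw qw)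

  -- The path is `a`, `z`, `w`, `b` if `z ~ w` and `a`, `z`, `q`, `w` if not, with `d` isolated from
  -- it. So the non-neighbourhoods of `z` and `w` cannot cross on an independent set.
  laminar : ∀ {q z w a b d} → q ≁ a → q ≁ b → q ≁ d → q ~ z → q ~ w → a ≁ b → a ≁ d → b ≁ d →
            z ~ a → z ≁ b → z ≁ d → w ≁ a → w ~ b → w ≁ d → ⊥
  laminar {z = z} {w} qa qb qd qz qw ab ad bd za zb zd wa wb wd with z ~? w
  ... | yes zw = ¬co-gem (~-sym za) zw wb (≁-sym wa) ab zb ad zd wd bd
  ... | no ¬zw = ¬co-gem (~-sym za) (~-sym qz) qw (≁-sym qa) (≁-sym wa) (¬-not ¬zw) ad zd qd wd

-- Criticality and recolouring.

colouring-avoiding : ∀ {k n} (G : Graph n) v → χ[ G -ᵥ v ]< k →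
                     ∃[ m ] m < k × Σ[ c ∈ (Fin n → ℕ) ] (∀ {x} → x ≢ v → c x < m) ×
                     (∀ {x y} → x ≢ v → y ≢ v → adj G x y ≡ true → c x ≢ c y)
colouring-avoiding {n = suc n} G v (m , ((c′ , proper) , _) , m<k) = m , m<k , c , c< , c-proper
  where
  c : Fin (suc n) → ℕ
  c x with v ≟ᶠ x
  -- A placeholder: every claim about `c` excludes `v`. Colours are natural numbers because `Fin m`
  -- may be empty.
  ... | yes _  = 0
  ... | no v≢x = toℕ (c′ (punchOut v≢x))

  c< : ∀ {x} → x ≢ v → c x < m
  c< {x} x≢v with v ≟ᶠ x
  ... | yes v≡x = contradiction (sym v≡x) x≢v
  ... | no _    = toℕ<n _

  c-proper : ∀ {x y} → x ≢ v → y ≢ v → adj G x y ≡ true → c x ≢ c y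
  c-proper {x} {y} x≢v y≢v x~y with v ≟ᶠ x | v ≟ᶠ y
  ... | yes v≡x | _       = contradiction (sym v≡x) x≢v
  ... | no _    | yes v≡y = contradiction (sym v≡y) y≢v
  ... | no v≢x  | no v≢y  = λ eq → proper _ _
        (trans (cong₂ (adj G) (punchIn-punchOut v≢x) (punchIn-punchOut v≢y)) x~y) (toℕ-injective eq)

module Criticality {k n} (G : Graph n) (critical : VertexCritical k G) where
  open Adjacency G

  colour : Fin n → Fin k
  colour = proj₁ (proj₁ (proj₁ critical))

  -- A proper colouring is injective on a clique.
  clique-length : {xs : List (Fin n)} → (∀ {x y} → x ∈ xs → y ∈ xs → x ≢ y → x ~ y) →
                  Bounded (_∈ xs) k
  clique-length adjacent = Bounded-injective (toℕ ∘ colour) (λ _ → toℕ<n _) inj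
    where
    inj : ∀ {x y} → x ∈ _ → y ∈ _ → toℕ (colour x) ≡ toℕ (colour y) → x ≡ y
    inj {x} {y} x∈ y∈ eq with x ≟ᶠ y
    ... | yes x≡y = x≡y
    ... | no x≢y  = contradiction (toℕ-injective eq) (proj₂ (proj₁ (proj₁ critical)) x y (adjacent x∈ y∈ x≢y))

  module _ (U : Pred (Fin n) 0ℓ) (U? : Decidable U) where

    Boundary : Fin n → Set
    Boundary z = ¬ U z × ∃[ u ] U u × z ~ u

    boundary? : Decidable Boundary
    boundary? z = ¬? (U? z) ×-dec anyFin? λ u → U? u ×-dec z ~? u

    -- Gluing `c` outside `U` to `g` on `U` would properly colour the whole graph with fewer than
    -- `k` colours.
    ¬recolour : ∀ {m} → m < k → (c g : Fin n → ℕ) →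
                (∀ {x} → ¬ U x → c x < m) → (∀ {x y} → ¬ U x → ¬ U y → x ~ y → c x ≢ c y) →
                (∀ {x} → U x → g x < m) → (∀ {x y} → U x → U y → x ~ y → g x ≢ g y) →
                (∀ {x y} → ¬ U x → U y → x ~ y → c x ≢ g y) → ⊥
    ¬recolour {m} m<k c g c< c-proper g< g-proper c≢g = <⇒≱ m<k (proj₂ (proj₁ critical) m
        ((λ x → fromℕ< (h< x)) , λ x y x~y eq → h-proper x y x~y
          (trans (sym (toℕ-fromℕ< (h< x))) (trans (cong toℕ eq) (toℕ-fromℕ< (h< y))))))
      where
      h : Fin n → ℕ
      h x with U? x
      ... | yes _ = g x
      ... | no _  = c x

      h< : ∀ x → h x < m
      h< x with U? x
      ... | yes Ux = g< Ux
      ... | no ¬Ux = c< ¬Ux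

      h-proper : ∀ x y → x ~ y → h x ≢ h y
      h-proper x y x~y with U? x | U? y
      ... | yes Ux | yes Uy = g-proper Ux Uy x~y
      ... | yes Ux | no ¬Uy = ≢-sym (c≢g ¬Uy Ux (~-sym x~y))
      ... | no ¬Ux | yes Uy = c≢g ¬Ux Uy x~y
      ... | no ¬Ux | no ¬Uy = c-proper ¬Ux ¬Uy x~y

    -- Colour G minus a vertex of U with fewer than k colours, and let zs contain one boundary vertex for
    -- each colour on the boundary of U. If zs had no member as claimed for h, then giving u in U the
    -- colour of h u would colour G with fewer than k colours.
    blockers : ∀ {v} → U v → ∃[ zs ] length zs ≤ k × (∀ (h : Fin n → Fin n) →
               (∀ {u} → U u → ¬ U (h u)) → (∀ {u u′} → U u → U u′ → u ~ u′ → h u ~ h u′) →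
               Any (λ z → Boundary z × ∃[ u ] U u × z ≁ h u) zs)
    blockers {v} Uv with colouring-avoiding G v (proj₂ critical v)
    ... | m , m<k , c , c< , c-proper
      with greedy (λ x y → c x ≟ℕ c y) refl (filter boundary? (allFin n))
    ...   | zs , zs⊆ , sep , dom = zs , len , blocked
      where
      outside : ∀ {x} → ¬ U x → x ≢ v
      outside ¬Ux refl = ¬Ux Uv

      boundary : ∀ {z} → z ∈ zs → Boundary z
      boundary z∈ = proj₂ (∈-filter⁻ boundary? {xs = allFin n} (All.lookup zs⊆ z∈))

      len : length zs ≤ k
      len = ≤-trans (Bounded-injective c (λ z∈ → c< (outside (proj₁ (boundary z∈)))) inj
                      (AllPairs.map (λ cx≢cy x≡y → cx≢cy (cong c x≡y)) sep) (All.tabulate (λ z∈ → z∈)))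
                    (<⇒≤ m<k)
        where
        inj : ∀ {x y} → x ∈ zs → y ∈ zs → c x ≡ c y → x ≡ y
        inj {x} {y} x∈ y∈ eq with x ≟ᶠ y
        ... | yes x≡y = x≡y
        ... | no x≢y  = contradiction eq (pairwise ≢-sym sep x∈ y∈ x≢y)

      blocked : ∀ (h : Fin n → Fin n) → (∀ {u} → U u → ¬ U (h u)) →
                (∀ {u u′} → U u → U u′ → u ~ u′ → h u ~ h u′) →
                Any (λ z → Boundary z × ∃[ u ] U u × z ≁ h u) zs
      blocked h h-out h-hom
        with any? (λ z → boundary? z ×-dec anyFin? λ u → U? u ×-dec z ≁? h u) zs
      ... | yes found = found
      ... | no ¬found = ⊥-elim (¬recolour m<k c (c ∘ h) (λ ¬Ux → c< (outside ¬Ux))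
              (λ ¬Ux ¬Uy → c-proper (outside ¬Ux) (outside ¬Uy))
              (λ Ux → c< (outside (h-out Ux)))
              (λ Ux Uy x~y → c-proper (outside (h-out Ux)) (outside (h-out Uy)) (h-hom Ux Uy x~y))
              clash)
        where
        clash : ∀ {x y} → ¬ U x → U y → x ~ y → c x ≢ c (h y)
        clash {x} {y} ¬Ux Uy x~y cx≡chy
          with find (dom (∈-filter⁺ boundary? (∈-allFin x) (¬Ux , y , Uy , x~y)))
        -- `z` represents the colour of `x`, which `h y` shares, so `z` and `h y` are not adjacent.
        ... | z , z∈ , cx≡cz = ¬found (lose z∈ (boundary z∈ , y , Uy , ¬-not λ z~hy →
                c-proper (outside (proj₁ (boundary z∈))) (outside (h-out Uy)) z~hy
                  (trans (sym cx≡cz) cx≡chy)))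

-- The factors count, in order: vertices of a maximal clique; clique sizes from 0 to `k`; components
-- of one size; representatives in a component; vertices of a twin class.
orderBound : ℕ → ℕ
orderBound k = k * (suc k * laminarBound k * k * laminarBound k)

-- Twin classes among the non-neighbours of a vertex.

module Order {k n} (G : Graph n) (critical : VertexCritical k G)
             (no-co-gem : G IsFreeOf co-gem) (no-paw+P₁ : G IsFreeOf (paw ⊕ P 1)) where
  open Adjacency G
  open ForbiddenSubgraphs G no-co-gem no-paw+P₁
  open Criticality G critical

  module NonNeighbours (q : Fin n) where

    Twins-≁ : ∀ {u v w} → q ≁ v → q ≁ w → Twins q u v → Twins q u w → v ≁ w
    Twins-≁ {w = w} qv qw uv uw = trans (sym (uv _ qw)) (trans (uw _ qw) (loopless G w))

    twin-class-bound : ∀ y → Bounded (λ x → q ≁ x × Twins q y x) (laminarBound k)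
    twin-class-bound y = Laminar⇒Bounded (λ z x → q ~? z ×-dec z ≁? x) k lam cov
      where
      S : Fin n → Fin n → Set
      S z x = q ~ z × z ≁ x

      lam : Laminar S (λ x → q ≁ x × Twins q y x)
      lam (qa , ya) (qb , yb) (qd , yd) ¬za (qz , zb) (_ , zd) (qw , wa) ¬wb (_ , wd) =
        laminar qa qb qd qz qw (Twins-≁ qa qb ya yb) (Twins-≁ qa qd ya yd) (Twins-≁ qb qd yb yd)
          (¬-not λ za → ¬za (qz , za)) zb zd wa (¬-not λ wb → ¬wb (qw , wb)) wd

      cov : Covered S k (λ x → q ≁ x × Twins q y x)
      -- Only `a` is recoloured, by the colour of `b`; the list `zs` is fixed before `b` is chosen.
      cov {a} (qa , ya) with blockers (_≡ a) (_≟ᶠ a) refl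
      ... | zs , len , blocked = zs , len , λ {b} (qb , yb) a≢b →
        Any.map (λ {z} → λ { ((z≢a , _ , refl , za) , _ , _ , zb) →
                   (λ (_ , z≁a) → ~-≁-contradiction za z≁a) ,
                   -- Were `z` not adjacent to `q`, the twins `a` and `b` would agree on it.
                   ¬-not (λ qz → ~-≁-contradiction (~-sym za) (trans (sym (ya z qz)) (trans (yb z qz) (≁-sym zb)))) ,
                   zb })
          (blocked (λ _ → b) (λ { refl → ≢-sym a≢b }) λ { refl refl a~a → contradiction refl (~⇒≢ a~a) })

    -- Twin representatives and the cliques they form.

    private
      greedyR = greedy (twins? q) (λ _ _ → refl) (filter (q ≁?_) (allFin n))

    R : List (Fin n)
    R = proj₁ greedyR

    R⇒≁ : ∀ {r} → r ∈ R → q ≁ r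
    R⇒≁ r∈ = proj₂ (∈-filter⁻ (q ≁?_) {xs = allFin n}
      (All.lookup (proj₁ (proj₂ greedyR)) r∈))

    R-separated : AllPairs (λ u v → ¬ Twins q u v) R
    R-separated = proj₁ (proj₂ (proj₂ greedyR))

    representative : ∀ {x} → q ≁ x → Any (Twins q x) R
    representative qx = proj₂ (proj₂ (proj₂ greedyR))
      (∈-filter⁺ (q ≁?_) (∈-allFin _) qx)

    R-unique : Unique R
    R-unique = AllPairs.map (λ { ¬uv refl → ¬uv (λ _ _ → refl) }) R-separated

    R-Twins⇒≡ : ∀ {u v} → u ∈ R → v ∈ R → Twins q u v → u ≡ v
    R-Twins⇒≡ {u} {v} u∈ v∈ uv with u ≟ᶠ v
    ... | yes u≡v = u≡v
    ... | no u≢v  = contradiction uv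
          (pairwise (λ ¬uv vu → ¬uv (λ x qx → sym (vu x qx))) R-separated u∈ v∈ u≢v)

    E : Fin n → Fin n → Set
    E u v = u ≡ v ⊎ u ~ v

    E? : ∀ u v → Dec (E u v)
    E? u v = u ≟ᶠ v ⊎-dec u ~? v

    E-sym : ∀ {u v} → E u v → E v u
    E-sym (inj₁ u≡v) = inj₁ (sym u≡v)
    E-sym (inj₂ u~v) = inj₂ (~-sym u~v)

    -- Non-adjacent representatives with a common neighbour are twins, hence equal. So `E` is an
    -- equivalence on `R`, and its classes are cliques.
    E-trans : ∀ {u v w} → u ∈ R → v ∈ R → w ∈ R → E u v → E v w → E u w
    E-trans u∈ v∈ w∈ (inj₁ refl) vw          = vw
    E-trans u∈ v∈ w∈ (inj₂ uv)   (inj₁ refl) = inj₂ uv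
    E-trans {u} {v} {w} u∈ v∈ w∈ (inj₂ uv) (inj₂ vw) with u ~? w
    ... | yes uw = inj₂ uw
    ... | no ¬uw = inj₁ (R-Twins⇒≡ u∈ w∈
          (common-neighbour⇒twins (R⇒≁ u∈) (R⇒≁ v∈) (R⇒≁ w∈) uv vw (¬-not ¬uw)))

    private
      greedyI = greedy E? (inj₁ refl) R

    I : List (Fin n)
    I = proj₁ greedyI

    I⊆R : ∀ {a} → a ∈ I → a ∈ R
    I⊆R = All.lookup (proj₁ (proj₂ greedyI))

    I-separated : AllPairs (λ u v → ¬ E u v) I
    I-separated = proj₁ (proj₂ (proj₂ greedyI))

    I-dominates : ∀ {r} → r ∈ R → Any (E r) I
    I-dominates = proj₂ (proj₂ (proj₂ greedyI))

    I-unique : Unique I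
    I-unique = AllPairs.map (λ ¬uv u≡v → ¬uv (inj₁ u≡v)) I-separated

    K[_] : Fin n → List (Fin n)
    K[ a ] = filter (E? a) R

    K⇒R : ∀ {a r} → r ∈ K[ a ] → r ∈ R
    K⇒R {a} r∈ = proj₁ (∈-filter⁻ (E? a) r∈)

    K⇒E : ∀ {a r} → r ∈ K[ a ] → E a r
    K⇒E {a} r∈ = proj₂ (∈-filter⁻ (E? a) {xs = R} r∈)

    ∈K : ∀ {a} → a ∈ I → a ∈ K[ a ]
    ∈K {a} a∈ = ∈-filter⁺ (E? a) (I⊆R a∈) (inj₁ refl)

    K-unique : ∀ a → Unique K[ a ]
    K-unique a = Unique-filter⁺ (E? a) R-unique

    K-E : ∀ {a r s} → a ∈ I → r ∈ K[ a ] → s ∈ K[ a ] → E r s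
    K-E a∈ r∈ s∈ = E-trans (K⇒R r∈) (I⊆R a∈) (K⇒R s∈) (E-sym (K⇒E r∈)) (K⇒E s∈)

    K-clique : ∀ {a r s} → a ∈ I → r ∈ K[ a ] → s ∈ K[ a ] → r ≢ s → r ~ s
    K-clique a∈ r∈ s∈ r≢s with K-E a∈ r∈ s∈
    ... | inj₁ r≡s = contradiction r≡s r≢s
    ... | inj₂ r~s = r~s

    K-disjoint : ∀ {a b r s} → a ∈ I → b ∈ I → a ≢ b → r ∈ K[ a ] → s ∈ K[ b ] → ¬ E r s
    K-disjoint a∈ b∈ a≢b r∈ s∈ rs =
      pairwise (λ ¬uv vu → ¬uv (E-sym vu)) I-separated a∈ b∈ a≢b
        (E-trans (I⊆R a∈) (K⇒R s∈) (I⊆R b∈)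
          (E-trans (I⊆R a∈) (K⇒R r∈) (K⇒R s∈) (K⇒E r∈) rs) (E-sym (K⇒E s∈)))

    K-≁ : ∀ {a b r s} → a ∈ I → b ∈ I → a ≢ b → r ∈ K[ a ] → s ∈ K[ b ] → r ≁ s
    K-≁ a∈ b∈ a≢b r∈ s∈ = ¬-not λ rs → K-disjoint a∈ b∈ a≢b r∈ s∈ (inj₂ rs)

    -- `r` and `r′` span an edge on which `z` is mixed, and `s` is adjacent to neither end.
    K-mixed : ∀ {z a b r r′ s} → q ~ z → a ∈ I → b ∈ I → a ≢ b → r ∈ K[ a ] → r′ ∈ K[ a ] → s ∈ K[ b ] →
              z ~ r → z ≁ r′ → z ~ s
    K-mixed qz a∈ b∈ a≢b r∈ r′∈ s∈ zr zr′ =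
      mixed-on-edge (R⇒≁ (K⇒R r∈)) (R⇒≁ (K⇒R r′∈)) (R⇒≁ (K⇒R s∈)) qz
        (K-clique a∈ r∈ r′∈ λ { refl → ~-≁-contradiction zr zr′ }) zr zr′
        (K-≁ a∈ b∈ a≢b r∈ s∈) (K-≁ a∈ b∈ a≢b r′∈ s∈)

    -- If a has a neighbour that is not adjacent to q, this is the connected component of a among the
    -- non-neighbours of q; otherwise it consists of all isolated ones, whence 2 ≤ j below.
    Component : Fin n → Pred (Fin n) 0ℓ
    Component a u = q ≁ u × Any (λ r → Twins q r u) K[ a ]

    component? : ∀ a → Decidable (Component a)
    component? a u = q ≁? u ×-dec any? (λ r → twins? q r u) K[ a ]

    -- The adjacency of `x` and `u` passes to their representatives, which therefore lie in the same
    -- clique.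
    Component-closed : ∀ {a u x} → a ∈ I → Component a u → q ≁ x → x ~ u → Component a x
    Component-closed {a} a∈ (qu , u∈) qx xu with find u∈ | find (representative qx)
    ... | r , r∈ , ru | s , s∈ , xs =
      qx , lose (∈-filter⁺ (E? a) s∈ (E-trans (I⊆R a∈) (K⇒R r∈) s∈ (K⇒E r∈) (inj₂ rs)))
             (λ y qy → sym (xs y qy))
      where
      rs : r ~ s
      rs = ~-sym (trans (sym (xs r (R⇒≁ (K⇒R r∈)))) (~-sym (trans (ru _ qx) (~-sym xu))))

    -- Cliques of equal size at least two.

    module _ {j : ℕ} (2≤j : 2 ≤ j) where

      S : Fin n → Fin n → Set
      S z a = q ~ z × Any (z ≁_) K[ a ]

      Size : Fin n → Set
      Size a = a ∈ I × length K[ a ] ≡ j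

      ¬S⇒~ : ∀ {z a r} → q ~ z → ¬ S z a → r ∈ K[ a ] → z ~ r
      ¬S⇒~ qz ¬za r∈ = ¬-not λ zr → ¬za (qz , lose r∈ zr)

      S-≢ : ∀ {z a b} → ¬ S z a → S z b → a ≢ b
      S-≢ ¬za zb refl = ¬za zb

      -- If `z` saw `a`, it would be mixed on `K[ a ]` and hence complete to `K[ b ]`. This reduces
      -- laminarity for cliques to `laminar` applied to their chosen vertices.
      S-S⇒≁ : ∀ {z a b} → a ∈ I → b ∈ I → a ≢ b → S z a → S z b → z ≁ a
      S-S⇒≁ {z} a∈ b∈ a≢b (qz , za) (_ , zb) with find za | find zb
      ... | r , r∈ , zr | s , s∈ , zs = ¬-not λ z~a →
        ~-≁-contradiction (K-mixed qz a∈ b∈ a≢b (∈K a∈) r∈ s∈ z~a zr) zs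

      lam : Laminar S Size
      lam (a∈ , _) (b∈ , _) (d∈ , _) ¬za zb zd wa ¬wb wd =
        laminar (R⇒≁ (I⊆R a∈)) (R⇒≁ (I⊆R b∈)) (R⇒≁ (I⊆R d∈)) (proj₁ zb) (proj₁ wa)
          (K-≁ a∈ b∈ (S-≢ ¬za zb) (∈K a∈) (∈K b∈))
          (K-≁ a∈ d∈ a≢d (∈K a∈) (∈K d∈))
          (K-≁ b∈ d∈ b≢d (∈K b∈) (∈K d∈))
          (¬S⇒~ (proj₁ zb) ¬za (∈K a∈))
          (S-S⇒≁ b∈ d∈ b≢d zb zd)
          (S-S⇒≁ d∈ b∈ (≢-sym b≢d) zd zb)
          (S-S⇒≁ a∈ d∈ a≢d wa wd)
          (¬S⇒~ (proj₁ wa) ¬wb (∈K b∈))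
          (S-S⇒≁ d∈ a∈ (≢-sym a≢d) wd wa)
        where
        a≢d = S-≢ ¬za zd
        b≢d = S-≢ ¬wb wd

      module _ {a b} (sa : Size a) (sb : Size b) (a≢b : a ≢ b) where
        private
          a∈ = proj₁ sa
          b∈ = proj₁ sb
          eq = trans (proj₂ sa) (sym (proj₂ sb))

        -- Sends `u` to the member of `K[ b ]` at the position that its twin has in `K[ a ]`, so
        -- each twin class goes to one vertex. Outside the component the value is arbitrary.
        transfer : Fin n → Fin n
        transfer u with component? a u
        ... | yes (_ , u∈) = lookup K[ b ] (cast eq (Any.index u∈))
        ... | no _         = u

        transfer-∈ : ∀ {u} → Component a u → transfer u ∈ K[ b ]
        transfer-∈ {u} Cu with component? a u
        ... | yes _  = ∈-lookup _
        ... | no ¬Cu = contradiction Cu ¬Cu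

        transfer-outside : ∀ {u} → Component a u → ¬ Component a (transfer u)
        transfer-outside Cu (_ , t∈) with find t∈
        ... | r , r∈ , rt = K-disjoint a∈ b∈ a≢b r∈ (transfer-∈ Cu)
              (inj₁ (R-Twins⇒≡ (K⇒R r∈) (K⇒R (transfer-∈ Cu)) rt))

        -- Adjacent vertices are not twins, so their images are distinct members of a clique.
        transfer-hom : ∀ {u v} → Component a u → Component a v → u ~ v → transfer u ~ transfer v
        transfer-hom {u} {v} Cu Cv uv with component? a u | component? a v
        ... | no ¬Cu         | _              = contradiction Cu ¬Cu
        ... | yes _          | no ¬Cv         = contradiction Cv ¬Cv
        ... | yes (qu , u∈) | yes (qv , v∈) =
          K-clique b∈ (∈-lookup (cast eq (Any.index u∈))) (∈-lookup (cast eq (Any.index v∈))) λ tu≡tv →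
            contradiction (Twins-≁ qu qv (lookup-index u∈) (subst (λ i → Twins q (lookup K[ a ] i) v)
              (sym (cast-injective (lookup-injective (K-unique b) tu≡tv))) (lookup-index v∈)))
              λ u≁v → ~-≁-contradiction uv u≁v
          where
          cast-injective : ∀ {i j} → cast eq i ≡ cast eq j → i ≡ j
          cast-injective {i} {j} ci≡cj = toℕ-injective
            (trans (sym (toℕ-cast eq i)) (trans (cong toℕ ci≡cj) (toℕ-cast eq j)))

        -- If `z` missed a vertex of `K[ a ]`, it would be mixed on an edge of the component of `a`
        -- and thus adjacent to all of `K[ b ]`, but it misses `transfer v`.
        blocker-separates : ∀ {z} → Boundary (Component a) (component? a) z →
                            ∃[ u ] Component a u × z ≁ transfer u → ¬ S z a × S z b
        blocker-separates {z} (¬Cz , u , Cu@(qu , u∈) , zu) (v , Cv , zt) with find u∈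
        ... | r , r∈ , ru = ¬za , qz , lose t∈ zt
          where
          t  = transfer v
          t∈ = transfer-∈ Cv

          qz : q ~ z
          qz = ¬-not λ q≁z → ¬Cz (Component-closed a∈ Cu q≁z zu)

          complete-off-r : ∀ {s} → s ∈ K[ a ] → s ≢ r → z ~ s
          complete-off-r {s} s∈ s≢r = ¬-not λ zs → ~-≁-contradiction
            (mixed-on-edge qu (R⇒≁ (K⇒R s∈)) (R⇒≁ (K⇒R t∈)) qz
              (trans (sym (ru s (R⇒≁ (K⇒R s∈)))) (K-clique a∈ r∈ s∈ (≢-sym s≢r))) zu zs
              (trans (sym (ru t (R⇒≁ (K⇒R t∈)))) (K-≁ a∈ b∈ a≢b r∈ t∈))
              (K-≁ a∈ b∈ a≢b s∈ t∈))
            zt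

          ¬za : ¬ S z a
          ¬za (_ , z≁) with find z≁
          ... | s , s∈ , zs with s ≟ᶠ r | ∃-other _≟ᶠ_ (K-unique a) (subst (2 ≤_) (sym (proj₂ sa)) 2≤j) r
          ...   | no s≢r | _              = ~-≁-contradiction (complete-off-r s∈ s≢r) zs
          -- `z` sees the twin `u` of `r` but misses `r` itself, and `u`, `r` are not adjacent;
          -- `2 ≤ j` supplies a further `p` that gives a mixed edge.
          ...   | yes _  | p , p∈ , p≢r = ~-≁-contradiction
                  (K-mixed qz a∈ b∈ a≢b p∈ s∈ t∈ (complete-off-r p∈ p≢r) zs) zt

      size-bound : Bounded Size (laminarBound k)
      size-bound = Laminar⇒Bounded (λ z a → q ~? z ×-dec any? (z ≁?_) K[ a ]) k lam cov
        where
        cov : Covered S k Size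
        cov {a} sa@(a∈ , _) with blockers (Component a) (component? a) {a}
                                   (R⇒≁ (I⊆R a∈) , lose (∈K a∈) (λ _ _ → refl))
        ... | zs , len , blocked = zs , len , λ sb a≢b →
          Any.map (λ (bz , u , Cu , zt) → blocker-separates sa sb a≢b bz (u , Cu , zt))
            (blocked (transfer sa sb a≢b) (transfer-outside sa sb a≢b) (transfer-hom sa sb a≢b))

    -- Assembling the bound on the order.

    -- The representative of a neighbour would be a second member of `K[ a ]`.
    isolated : ∀ {a} → a ∈ I → length K[ a ] ≤ 1 → ∀ x → q ≁ x → a ≁ x
    isolated {a} a∈ small x qx = ¬-not λ ax → absurd ax
      where
      absurd : a ~ x → ⊥
      absurd ax with find (representative qx)
      ... | r , r∈ , xr = ~⇒≢ ar (length≤1⇒≡ small (∈K a∈) (∈-filter⁺ (E? a) r∈ (inj₂ ar)))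
        where
        ar : a ~ r
        ar = ~-sym (trans (sym (xr a (R⇒≁ (I⊆R a∈)))) (~-sym ax))

    sized-bound : ∀ j → Bounded (λ a → a ∈ I × length K[ a ] ≡ j) (laminarBound k)
    sized-bound j uniq all with 2 ≤? j
    ... | yes 2≤j = size-bound 2≤j uniq all
    -- Vertices isolated among the non-neighbours of `q` are twins of each other, so only one of
    -- them is a representative.
    ... | no ¬2≤j = ≤-trans (Bounded-≡ same uniq all) (1≤laminarBound k)
      where
      same : ∀ {a b} → a ∈ I × length K[ a ] ≡ j → b ∈ I × length K[ b ] ≡ j → a ≡ b
      same (a∈ , refl) (b∈ , eq) = R-Twins⇒≡ (I⊆R a∈) (I⊆R b∈) λ x qx →
        trans (isolated a∈ (s≤s⁻¹ (≰⇒> ¬2≤j)) x qx)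
              (sym (isolated b∈ (subst (_≤ 1) (sym eq) (s≤s⁻¹ (≰⇒> ¬2≤j))) x qx))

    K-bound : ∀ {a} → a ∈ I → Bounded (_∈ K[ a ]) k
    K-bound a∈ = clique-length (K-clique a∈)

    I-bound : Bounded (_∈ I) (suc k * laminarBound k)
    I-bound = Bounded-cover (upTo (suc k)) (≤-reflexive (length-upTo (suc k)))
      (λ j a → length K[ a ] ≟ℕ j)
      (λ a∈ → ∈-upTo⁺ (s≤s (K-bound a∈ (K-unique _) (All.tabulate λ r∈ → r∈))))
      (λ {j} _ → sized-bound j)

    R-bound : Bounded (_∈ R) (suc k * laminarBound k * k)
    R-bound = Bounded-cover I (I-bound I-unique (All.tabulate λ a∈ → a∈)) E?
      (λ r∈ → Any.map E-sym (I-dominates r∈))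
      (λ {a} a∈ uniq all → K-bound a∈ uniq (All.map (λ (r∈ , ar) → ∈-filter⁺ (E? a) r∈ ar) all))

    non-neighbours-bound : Bounded (q ≁_) (suc k * laminarBound k * k * laminarBound k)
    non-neighbours-bound = Bounded-cover R (R-bound R-unique (All.tabulate λ r∈ → r∈)) (twins? q)
      (λ qx → Any.map (λ xr y qy → sym (xr y qy)) (representative qx))
      (λ {y} _ → twin-class-bound y)

  -- `Q` is a maximal clique. Its own vertices are covered too, since each is a non-neighbour of
  -- itself.
  vertices-bound : Bounded {A = Fin n} (λ _ → ⊤) (orderBound k)
  vertices-bound with greedy _≁?_ (λ {v} → loopless G v) (allFin n)
  ... | Q , _ , sep , dom = Bounded-cover Q
    (clique-length (λ x∈ y∈ x≢y → pairwise ~-sym (AllPairs.map ¬-not sep) x∈ y∈ x≢y)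
      (AllPairs.map (λ { ¬uu refl → ¬uu (loopless G _) }) sep) (All.tabulate λ x∈ → x∈))
    _≁?_ (λ _ → Any.map ≁-sym (dom (∈-allFin _)))
    (λ {q} _ uniq all → NonNeighbours.non-neighbours-bound q uniq (All.map proj₂ all))

  order-bound : n ≤ orderBound k
  order-bound = subst (_≤ orderBound k) (length-tabulate {n = n} (λ v → v))
    (vertices-bound (allFin⁺ n) (All.universal _ _))

-- Enumeration of the graphs of a given order.

vectors : ∀ {A : Set} → List A → ∀ n → List (Vec A n)
vectors xs zero    = [] ∷ []
vectors xs (suc n) = cartesianProductWith _∷_ xs (vectors xs n)

∈-vectors : ∀ {A : Set} {xs : List A} → (∀ x → x ∈ xs) → ∀ {n} (v : Vec A n) → v ∈ vectors xs n
∈-vectors complete []      = here refl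
∈-vectors complete (x ∷ v) = ∈-cartesianProductWith⁺ _∷_ (complete x) (∈-vectors complete v)

-- A Boolean matrix need not be symmetric or have a zero diagonal, so both are forced.
fromMatrix : ∀ {n} → Vec (Vec Bool n) n → Graph n
fromMatrix {n} m = record
  { adj       = λ u v → (entry u v ∧ entry v u) ∧ adj (K n) u v
  ; symmetric = λ u v → cong₂ _∧_ (∧-comm (entry u v) (entry v u)) (symmetric (K n) u v)
  ; loopless  = λ v → trans (cong ((entry v v ∧ entry v v) ∧_) (loopless (K n) v)) (∧-zeroʳ _)
  }
  where
  entry : Fin n → Fin n → Bool
  entry u v = Vec.lookup (Vec.lookup m u) v

matrix : ∀ {n} → Graph n → Vec (Vec Bool n) n
matrix G = Vec.tabulate λ u → Vec.tabulate (adj G u)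

fromMatrix-matrix : ∀ {n} (G : Graph n) → G ≅ fromMatrix (matrix G)
fromMatrix-matrix {n} G = ↔-id _ , λ u v → sym (trans
    (cong (_∧ adj (K n) u v) (cong₂ _∧_ (entry u v) (trans (entry v u) (symmetric G v u))))
    (off-diagonal u v))
  where
  entry : ∀ u v → Vec.lookup (Vec.lookup (matrix G) u) v ≡ adj G u v
  entry u v = trans (cong (λ r → Vec.lookup r v) (lookup∘tabulate (λ u → Vec.tabulate (adj G u)) u))
    (lookup∘tabulate (adj G u) v)

  off-diagonal : ∀ u v → (adj G u v ∧ adj G u v) ∧ adj (K n) u v ≡ adj G u v
  off-diagonal u v with u ≟ᶠ v
  ... | yes refl = trans (∧-zeroʳ _) (sym (loopless G u))
  ... | no _     = trans (∧-identityʳ _) (∧-idem _)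

graphs : ℕ → List (∃ Graph)
graphs n = map (λ m → n , fromMatrix m) (vectors (vectors (true ∷ false ∷ []) n) n)

graphs-complete : ∀ {n} (G : Graph n) → Any (λ H → G ≅ proj₂ H) (graphs n)
graphs-complete {n} G = lose (∈-map⁺ _ (∈-vectors (∈-vectors bool) (matrix G))) (fromMatrix-matrix G)
  where
  bool : ∀ b → b ∈ true ∷ false ∷ []
  bool true  = here refl
  bool false = there (here refl)

theorem4p1 : (k : ℕ) → k ≥ 1 →
    FinitelyManyUpToIso (λ G →
    VertexCritical k G × G IsFreeOf co-gem × G IsFreeOf (paw ⊕ P 1))
theorem4p1 k _ = concatMap graphs (upTo (suc (orderBound k))) , λ G (critical , no-co-gem , no-paw+P₁) →
  let H , H∈ , G≅H = find (graphs-complete G)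
      n≤bound = Order.order-bound G critical no-co-gem no-paw+P₁
  in lose (∈-concatMap⁺ graphs (lose (∈-upTo⁺ (s≤s n≤bound)) H∈)) G≅H
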